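{- Let $\mathcal{X}$ and $\mathcal{Y}$ be finite sets, $g:\mathcal{X}\times\mathcal{Y}\to\mathbb{R}_{>0}$ a strictly positive function, and $h:\mathcal{Y}\to\mathbb{R}_{\ge0}$ a non-negative function. Then, writing $X\sim p$ and $Y\sim q$ in all expectations, \[ \max_{q\in\Delta(\mathcal{Y})}\min_{x\in\mathcal{X}}\mathbb{E}\frac{g(x,Y)}{h(Y)} =\min_{p\in\Delta(\mathcal{X})}\max_{y\in\mathcal{Y}}\frac{\mathbb{E}\,g(X,y)}{h(y)} =\max_{q\in\Delta(\mathcal{Y})}\min_{p\in\Delta(\mathcal{X})}\frac{\mathbb{E}\,g(X,Y)}{\mathbb{E}\,h(Y)} =\min_{p\in\Delta(\mathcal{X})}\max_{q\in\Delta(\mathcal{Y})}\frac{\mathbb{E}\,g(X,Y)}{\mathbb{E}\,h(Y)}. \]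
   Context: For a finite set $U$, $\Delta(U)$ denotes the set of all probability distributions on $U$; $X$ and $Y$ are independent. -}

module Defs where

open import Level using (_⊔_) renaming (suc to lsuc)
open import Algebra.Bundles using (CommutativeRing)
open import Data.Fin.Base using (Fin)
open import Data.Nat.Base using (ℕ)
open import Data.Product.Base using (∃; _×_; proj₁)
import Data.Vec.Functional as Vector
open import Function.Bundles using (_↔_; Inverse)
open import Relation.Binary.Core using (Rel)
open import Relation.Binary.Structures using (IsDecTotalOrder)
import Relation.Binary.Construct.Add.Supremum.Equality as AddSupremumEquality
import Relation.Binary.Construct.Add.Supremum.NonStrict as AddSupremumOrder
import Relation.Binary.Construct.NonStrictToStrict as ToStrict
open import Relation.Nullary.Decidable.Core using (yes; no)
open import Relation.Nullary.Negation.Core using (¬_)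
open import Relation.Nullary.Construct.Add.Supremum using (_⁺; [_]; ⊤⁺)
open import Relation.Unary using (Pred; _∈_)

-- The real numbers, given by their classical axioms as a Dedekind-complete
-- ordered field; these determine ℝ up to unique isomorphism.  In the classical
-- reading, trichotomy is the decidability contained in IsDecTotalOrder.
record Reals c ℓ₁ ℓ₂ : Set (lsuc (c ⊔ ℓ₁ ⊔ ℓ₂)) where
  infix 4 _≤_
  field
    commutativeRing : CommutativeRing c ℓ₁
  open CommutativeRing commutativeRing public
  field
    0≉1             : ¬ (0# ≈ 1#)
    inverse         : ∀ x → ¬ (x ≈ 0#) → ∃ λ y → x * y ≈ 1#
    _≤_             : Rel Carrier ℓ₂
    isDecTotalOrder : IsDecTotalOrder _≈_ _≤_
    +-mono-≤        : ∀ {x y u v} → x ≤ y → u ≤ v → x + u ≤ y + v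
    *-nonNegative   : ∀ {x y} → 0# ≤ x → 0# ≤ y → 0# ≤ x * y

  UpperBound : Pred Carrier (c ⊔ ℓ₁ ⊔ ℓ₂) → Pred Carrier (c ⊔ ℓ₁ ⊔ ℓ₂)
  UpperBound S u = ∀ x → x ∈ S → x ≤ u

  field
    leastUpperBound : (S : Pred Carrier (c ⊔ ℓ₁ ⊔ ℓ₂)) → ∃ S → ∃ (UpperBound S) →
                      ∃ λ s → UpperBound S s × (∀ u → UpperBound S u → s ≤ u)

  open IsDecTotalOrder isDecTotalOrder public using (_≟_; _≤?_)
  open ToStrict _≈_ _≤_ public using (_<_)

record FiniteSet a : Set (lsuc a) where
  field
    Element     : Set a
    size        : ℕ
    enumeration : Fin size ↔ Element

  element : Fin size → Element
  element = Inverse.to enumeration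

open FiniteSet public using (Element)

module Extended {c ℓ₁ ℓ₂} (ℝ : Reals c ℓ₁ ℓ₂) where
  open Reals ℝ

  -- ℝ ∪ {+∞}, with +∞ = ⊤⁺
  ℝ∞ : Set c
  ℝ∞ = Carrier ⁺

  open AddSupremumEquality _≈_ public using (_≈⁺_)
  open AddSupremumOrder _≤_ public using (_≤⁺_)

  infixl 6 _+⁺_
  infixl 7 _·⁺_ _÷_

  _+⁺_ : ℝ∞ → ℝ∞ → ℝ∞
  [ x ] +⁺ [ y ] = [ x + y ]
  [ _ ] +⁺ ⊤⁺    = ⊤⁺
  ⊤⁺    +⁺ _     = ⊤⁺

  -- Scaling by a non-negative weight, with 0 · (+∞) = 0.
  _·⁺_ : Carrier → ℝ∞ → ℝ∞
  w ·⁺ [ x ] = [ w * x ]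
  w ·⁺ ⊤⁺ with w ≟ 0#
  ... | yes _ = [ 0# ]
  ... | no  _ = ⊤⁺

  -- Division with a / 0 = +∞, meant for numerators a > 0.
  _÷_ : Carrier → Carrier → ℝ∞
  a ÷ b with b ≟ 0#
  ... | yes _   = ⊤⁺
  ... | no  b≉0 = [ a * proj₁ (inverse b b≉0) ]

  module _ {a} (U : FiniteSet a) where
    open FiniteSet U using (element)

    ∑ : (Element U → Carrier) → Carrier
    ∑ f = Vector.foldr _+_ 0# (λ i → f (element i))

    ∑⁺ : (Element U → ℝ∞) → ℝ∞
    ∑⁺ f = Vector.foldr _+⁺_ [ 0# ] (λ i → f (element i))

  record Δ {a} (U : FiniteSet a) : Set (a ⊔ c ⊔ ℓ₁ ⊔ ℓ₂) where
    field
      mass        : Element U → Carrier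
      nonNegative : ∀ u → 0# ≤ mass u
      total       : ∑ U mass ≈ 1#

  open Δ public using (mass)

  module _ {a} {U : FiniteSet a} where

    𝔼 : Δ U → (Element U → Carrier) → Carrier
    𝔼 p f = ∑ U λ u → mass p u * f u

    𝔼⁺ : Δ U → (Element U → ℝ∞) → ℝ∞
    𝔼⁺ p f = ∑⁺ U λ u → mass p u ·⁺ f u

  -- Expectation of f(X , Y) for independent X ∼ p and Y ∼ q: the joint law
  -- gives mass p(x) q(y) to (x , y).
  𝔼₂ : ∀ {a b} {U : FiniteSet a} {V : FiniteSet b} →
       Δ U → Δ V → (Element U → Element V → Carrier) → Carrier
  𝔼₂ {U = U} {V = V} p q f = ∑ U λ x → ∑ V λ y → (mass p x * mass q y) * f x y

  -- Maxima and minima are attained; being one is a relation between a function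
  -- and a value.
  module _ {a} {A : Set a} where

    IsMax : (A → ℝ∞) → ℝ∞ → Set (a ⊔ c ⊔ ℓ₁ ⊔ ℓ₂)
    IsMax f v = (∃ λ x → f x ≈⁺ v) × (∀ x → f x ≤⁺ v)

    IsMin : (A → ℝ∞) → ℝ∞ → Set (a ⊔ c ⊔ ℓ₁ ⊔ ℓ₂)
    IsMin f v = (∃ λ x → f x ≈⁺ v) × (∀ x → v ≤⁺ f x)

  module _ {a b} {A : Set a} {B : Set b} where

    -- v = max_x min_y F x y, including existence of every inner minimum.
    IsMaxMin : (A → B → ℝ∞) → ℝ∞ → Set (a ⊔ b ⊔ c ⊔ ℓ₁ ⊔ ℓ₂)
    IsMaxMin F v = ∃ λ (m : A → ℝ∞) → (∀ x → IsMin (F x) (m x)) × IsMax m v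

    -- v = min_x max_y F x y, including existence of every inner maximum.
    IsMinMax : (A → B → ℝ∞) → ℝ∞ → Set (a ⊔ b ⊔ c ⊔ ℓ₁ ⊔ ℓ₂)
    IsMinMax F v = ∃ λ (m : A → ℝ∞) → (∀ x → IsMax (F x) (m x)) × IsMin m v

{-# OPTIONS --safe #-}
module Submission where

-- For h > 0 all four expressions are values of the linear program max Σp subject to pG ≤ h and of its
-- dual min q·h subject to Gq ≥ 1, with common optimum 1/v: optimal p and q, normalised, are optimal
-- strategies, and reweighting q by h passes between the mean of the ratios and the ratio of the means.
-- Pure columns suffice against a fixed p because a mediant Σ q s / Σ q h is at most max s / h.
-- Strong duality is Farkas' lemma applied to the primal and dual constraints together with
-- q·h ≤ Σp.  If h vanishes somewhere, all values are +∞, witnessed by a point mass.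

open import Defs
open import Data.Product.Base using (∃; _×_; _,_; proj₁; proj₂)
import Algebra.Properties.Ring as RingProperties
import Algebra.Properties.Semiring.Sum as SemiringSum
import Algebra.Solver.Ring.NaturalCoefficients.Default as SemiringSolver
open import Data.Fin.Base using (Fin; zero; suc; _↑ˡ_; _↑ʳ_)
open import Data.Fin.Properties using (any?)
open import Data.List.Base using (tabulate)
import Data.List.Extrema as Extrema
open import Data.List.Membership.Propositional.Properties using (∈-tabulate⁺)
import Data.List.Relation.Unary.All as All
open import Data.Nat.Base as ℕ using (zero; suc)
open import Data.Sum.Base using (_⊎_; inj₁; inj₂)
open import Data.Vec.Functional using (Vector; _∷_; _++_; foldr)
open import Data.Vec.Functional.Properties using (lookup-++ˡ; lookup-++ʳ)
open import Function.Base using (_∘_)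
open import Function.Bundles using (Inverse)
open import Level using (_⊔_)
open import Relation.Binary.Bundles using (Poset; TotalOrder)
open import Relation.Binary.Construct.Add.Supremum.Equality using ([_])
open import Relation.Binary.Construct.Add.Supremum.NonStrict using (≤⁺-isTotalOrder; [≤]-injective; [_]; _≤⊤⁺)
open import Relation.Binary.PropositionalEquality.Core as ≡ using (_≡_)
import Relation.Binary.Reasoning.PartialOrder as PosetReasoning
open import Relation.Binary.Structures using (IsDecTotalOrder; IsTotalOrder)
open import Relation.Nullary.Construct.Add.Supremum using ([_]; ⊤⁺)
open import Relation.Nullary.Decidable.Core using (Dec; yes; no)
open import Relation.Nullary.Negation.Core using (¬_; contradiction)

-- Order and arithmetic in an ordered field.

module OrderedField {c ℓ₁ ℓ₂} (ℝ : Reals c ℓ₁ ℓ₂) where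
  open Reals ℝ public hiding (zero)
  open IsDecTotalOrder isDecTotalOrder public
    using (isPartialOrder; isTotalOrder)
    renaming (refl to ≤-refl; reflexive to ≤-reflexive; trans to ≤-trans; antisym to ≤-antisym; total to ≤-total)
  open RingProperties ring public using (-‿distribˡ-*; -‿distribʳ-*)
  open SemiringSum semiring public
  open SemiringSolver commutativeSemiring public using (solve; _:+_; _:*_; _:=_)

  ≤-poset : Poset c ℓ₁ ℓ₂
  ≤-poset = record { isPartialOrder = isPartialOrder }

  open PosetReasoning ≤-poset public

  -- Strict positivity is used below as `¬ (x ≤ 0#)`, the form that a `no` from `_≤?_` delivers;
  -- this lemma and the next recover the weak inequality and nonvanishing from it.
  ≰⇒≥ : ∀ {x y} → ¬ (x ≤ y) → y ≤ x
  ≰⇒≥ {x} {y} x≰y with ≤-total x y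
  ... | inj₁ x≤y = contradiction x≤y x≰y
  ... | inj₂ y≤x = y≤x

  ≰⇒≉ : ∀ {x y} → ¬ (x ≤ y) → ¬ (x ≈ y)
  ≰⇒≉ x≰y x≈y = x≰y (≤-reflexive x≈y)

  +-cancelʳ-≤ : ∀ z {x y} → x + z ≤ y + z → x ≤ y
  +-cancelʳ-≤ z {x} {y} x+z≤y+z = begin
    x              ≈⟨ cancel x ⟨
    x + z + (- z)  ≤⟨ +-mono-≤ x+z≤y+z ≤-refl ⟩
    y + z + (- z)  ≈⟨ cancel y ⟩
    y              ∎
    where
    cancel : ∀ w → w + z + (- z) ≈ w
    cancel w = trans (+-assoc w z (- z)) (trans (+-congˡ (-‿inverseʳ z)) (+-identityʳ w))

  x-y≤0⇒x≤y : ∀ {x y} → x + (- y) ≤ 0# → x ≤ y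
  x-y≤0⇒x≤y {x} {y} x-y≤0 = +-cancelʳ-≤ (- y) (≤-trans x-y≤0 (≤-reflexive (sym (-‿inverseʳ y))))

  x≤y⇒0≤y-x : ∀ {x y} → x ≤ y → 0# ≤ y + (- x)
  x≤y⇒0≤y-x {x} {y} x≤y = ≤-trans (≤-reflexive (sym (-‿inverseʳ x))) (+-mono-≤ x≤y ≤-refl)

  -x≤-y⇒y≤x : ∀ {x y} → - x ≤ - y → y ≤ x
  -x≤-y⇒y≤x {x} {y} -x≤-y = x-y≤0⇒x≤y (begin
    y + (- x)  ≤⟨ +-mono-≤ ≤-refl -x≤-y ⟩
    y + (- y)  ≈⟨ -‿inverseʳ y ⟩
    0#         ∎)

  neg-≤0 : ∀ {x} → 0# ≤ x → - x ≤ 0#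
  neg-≤0 {x} 0≤x = begin
    - x       ≈⟨ +-identityˡ (- x) ⟨
    0# + - x  ≤⟨ +-mono-≤ 0≤x ≤-refl ⟩
    x + - x   ≈⟨ -‿inverseʳ x ⟩
    0#        ∎

  0≤neg : ∀ {x} → x ≤ 0# → 0# ≤ - x
  0≤neg {x} x≤0 = ≤-trans (x≤y⇒0≤y-x x≤0) (≤-reflexive (+-identityˡ (- x)))

  *-monoˡ-≤ : ∀ {z x y} → 0# ≤ z → x ≤ y → z * x ≤ z * y
  *-monoˡ-≤ {z} {x} {y} 0≤z x≤y = +-cancelʳ-≤ (z * - x) (begin
    z * x + z * - x  ≈⟨ distribˡ z x (- x) ⟨
    z * (x + - x)    ≈⟨ *-congˡ (-‿inverseʳ x) ⟩
    z * 0#           ≈⟨ zeroʳ z ⟩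
    0#               ≤⟨ *-nonNegative 0≤z (x≤y⇒0≤y-x x≤y) ⟩
    z * (y + - x)    ≈⟨ distribˡ z y (- x) ⟩
    z * y + z * - x  ∎)

  *-nonPositive : ∀ {x y} → 0# ≤ x → y ≤ 0# → x * y ≤ 0#
  *-nonPositive {x} 0≤x y≤0 = ≤-trans (*-monoˡ-≤ 0≤x y≤0) (≤-reflexive (zeroʳ x))

  square-nonNegative : ∀ x → 0# ≤ x * x
  square-nonNegative x with ≤-total 0# x
  ... | inj₁ 0≤x = *-nonNegative 0≤x 0≤x
  ... | inj₂ x≤0 = begin
    0#             ≤⟨ 0≤neg (*-nonPositive (0≤neg x≤0) x≤0) ⟩
    - (- x * x)    ≈⟨ -‿cong (-‿distribˡ-* x x) ⟨
    - (- (x * x))  ≈⟨ -‿involutive (x * x) ⟩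
    x * x          ∎
    where open RingProperties ring using (-‿involutive)

  0≤1 : 0# ≤ 1#
  0≤1 = ≤-trans (square-nonNegative 1#) (≤-reflexive (*-identityˡ 1#))

  1≰0 : ¬ (1# ≤ 0#)
  1≰0 1≤0 = 0≉1 (≤-antisym 0≤1 1≤0)

  0<⇒≰ : ∀ {x} → 0# < x → ¬ (x ≤ 0#)
  0<⇒≰ (0≤x , 0≉x) x≤0 = 0≉x (≤-antisym 0≤x x≤0)

  inverse-nonNegative : ∀ {x y} → 0# ≤ x → x * y ≈ 1# → 0# ≤ y
  inverse-nonNegative {x} {y} 0≤x xy≈1 with ≤-total 0# y
  ... | inj₁ 0≤y = 0≤y
  ... | inj₂ y≤0 = contradiction (≤-trans (≤-reflexive (sym xy≈1)) (*-nonPositive 0≤x y≤0)) 1≰0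

  *-cancelˡ-≤ : ∀ {z x y} → ¬ (z ≤ 0#) → z * x ≤ z * y → x ≤ y
  *-cancelˡ-≤ {z} {x} {y} z≰0 zx≤zy = begin
    x            ≈⟨ cancel x ⟨
    w * (z * x)  ≤⟨ *-monoˡ-≤ (inverse-nonNegative (≰⇒≥ z≰0) zw≈1) zx≤zy ⟩
    w * (z * y)  ≈⟨ cancel y ⟩
    y            ∎
    where
    w = proj₁ (inverse z (≰⇒≉ z≰0))
    zw≈1 = proj₂ (inverse z (≰⇒≉ z≰0))
    cancel : ∀ t → w * (z * t) ≈ t
    cancel t = trans (sym (*-assoc w z t)) (trans (*-congʳ (trans (*-comm w z) zw≈1)) (*-identityˡ t))

  *-≤0⇒≤0 : ∀ {z x} → ¬ (z ≤ 0#) → z * x ≤ 0# → x ≤ 0#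
  *-≤0⇒≤0 {z} z≰0 zx≤0 = *-cancelˡ-≤ z≰0 (≤-trans zx≤0 (≤-reflexive (sym (zeroʳ z))))

  -- A nonzero `x` has an inverse `y`, and then `1 = (y * y) * (x * x) ≤ 0`.
  square≤0⇒≈0 : ∀ {x} → x * x ≤ 0# → x ≈ 0#
  square≤0⇒≈0 {x} xx≤0 with x ≟ 0#
  ... | yes x≈0 = x≈0
  ... | no  x≉0 = contradiction (begin
    1#                 ≈⟨ *-identityˡ 1# ⟨
    1# * 1#            ≈⟨ *-cong xy≈1 xy≈1 ⟨
    (x * y) * (x * y)  ≈⟨ solve 2 (λ a b → (a :* b) :* (a :* b) := (b :* b) :* (a :* a)) refl x y ⟩
    (y * y) * (x * x)  ≤⟨ *-nonPositive (square-nonNegative y) xx≤0 ⟩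
    0#                 ∎) 1≰0
    where
    y = proj₁ (inverse x x≉0)
    xy≈1 = proj₂ (inverse x x≉0)

  -- Inequalities and splitting for finite sums.

  sum-mono-≤ : ∀ {n} {f g : Vector Carrier n} → (∀ i → f i ≤ g i) → sum f ≤ sum g
  sum-mono-≤ {zero}  f≤g = ≤-refl
  sum-mono-≤ {suc n} f≤g = +-mono-≤ (f≤g zero) (sum-mono-≤ (f≤g ∘ suc))

  sum-zero : ∀ {n} {f : Vector Carrier n} → (∀ i → f i ≈ 0#) → sum f ≈ 0#
  sum-zero {n} f≈0 = trans (sum-cong-≋ f≈0) (sum-replicate-zero n)

  sum-nonNegative : ∀ {n} {f : Vector Carrier n} → (∀ i → 0# ≤ f i) → 0# ≤ sum f
  sum-nonNegative {n} 0≤f = ≤-trans (≤-reflexive (sym (sum-replicate-zero n))) (sum-mono-≤ 0≤f)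

  sum-nonPositive : ∀ {n} {f : Vector Carrier n} → (∀ i → f i ≤ 0#) → sum f ≤ 0#
  sum-nonPositive {n} f≤0 = ≤-trans (sum-mono-≤ f≤0) (≤-reflexive (sum-replicate-zero n))

  term≤sum : ∀ {n} {f : Vector Carrier n} → (∀ i → 0# ≤ f i) → ∀ i → f i ≤ sum f
  term≤sum {suc n} {f} 0≤f zero = begin
    f zero                  ≈⟨ +-identityʳ (f zero) ⟨
    f zero + 0#             ≤⟨ +-mono-≤ ≤-refl (sum-nonNegative (0≤f ∘ suc)) ⟩
    f zero + sum (f ∘ suc)  ∎
  term≤sum {suc n} {f} 0≤f (suc i) = begin
    f (suc i)               ≈⟨ +-identityˡ (f (suc i)) ⟨
    0# + f (suc i)          ≤⟨ +-mono-≤ (0≤f zero) (term≤sum (0≤f ∘ suc) i) ⟩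
    f zero + sum (f ∘ suc)  ∎

  sum-split : ∀ m {n} (f : Vector Carrier (m ℕ.+ n)) →
              sum f ≈ sum (λ i → f (i ↑ˡ n)) + sum (λ j → f (m ↑ʳ j))
  sum-split zero    f = sym (+-identityˡ (sum f))
  sum-split (suc m) f = trans (+-congˡ (sum-split m (f ∘ suc))) (sym (+-assoc _ _ _))

  sum-neg : ∀ {n} (f : Vector Carrier n) → sum (λ i → - f i) ≈ - sum f
  sum-neg f = uniqueʳ _ _ (trans (sym (∑-distrib-+ f _)) (sum-zero λ i → -‿inverseʳ (f i)))
    where open RingProperties ring renaming (+-inverseʳ-unique to uniqueʳ)

  -- Unit vectors and dot products.

  δ : ∀ {n} → Fin n → Vector Carrier n
  δ zero    zero    = 1#
  δ zero    (suc j) = 0#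
  δ (suc i) zero    = 0#
  δ (suc i) (suc j) = δ i j

  δ-nonNegative : ∀ {n} (i j : Fin n) → 0# ≤ δ i j
  δ-nonNegative zero    zero    = 0≤1
  δ-nonNegative zero    (suc j) = ≤-refl
  δ-nonNegative (suc i) zero    = ≤-refl
  δ-nonNegative (suc i) (suc j) = δ-nonNegative i j

  infix 8 _∙_
  _∙_ : ∀ {n} → Vector Carrier n → Vector Carrier n → Carrier
  a ∙ x = sum λ i → a i * x i

  δ-∙ : ∀ {n} (i : Fin n) f → δ i ∙ f ≈ f i
  δ-∙ zero    f = trans (+-cong (*-identityˡ (f zero)) (sum-zero λ j → zeroˡ (f (suc j)))) (+-identityʳ (f zero))
  δ-∙ (suc i) f = trans (+-cong (zeroˡ (f zero)) (δ-∙ i (f ∘ suc))) (+-identityˡ (f (suc i)))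

  ∙-comm : ∀ {n} (a x : Vector Carrier n) → a ∙ x ≈ x ∙ a
  ∙-comm a x = sum-cong-≋ λ i → *-comm (a i) (x i)

  infixl 6 _⊕_·_
  _⊕_·_ : ∀ {n} → Vector Carrier n → Carrier → Vector Carrier n → Vector Carrier n
  (a ⊕ t · b) i = a i + t * b i

  ∙-⊕ʳ : ∀ {n} (a x : Vector Carrier n) t y → a ∙ (x ⊕ t · y) ≈ a ∙ x + t * (a ∙ y)
  ∙-⊕ʳ a x t y = trans
    (sum-cong-≋ λ i → solve 4 (λ a x t y → a :* (x :+ t :* y) := a :* x :+ t :* (a :* y)) refl (a i) (x i) t (y i))
    (trans (∑-distrib-+ (λ i → a i * x i) _) (+-congˡ (sym (*-distribˡ-sum t λ i → a i * y i))))

  ∙-⊕ˡ : ∀ {n} (a : Vector Carrier n) t b x → (a ⊕ t · b) ∙ x ≈ a ∙ x + t * (b ∙ x)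
  ∙-⊕ˡ a t b x = trans (∙-comm (a ⊕ t · b) x) (trans (∙-⊕ʳ x a t b) (+-cong (∙-comm x a) (*-congˡ (∙-comm x b))))

  -- Interchange of two finite sums: it provides the bilinear form of weak duality and, later, the
  -- exchange of expectations.
  ∙-swap : ∀ {m n} (p : Vector Carrier m) (q : Vector Carrier n) (f : Fin m → Fin n → Carrier) →
           p ∙ (λ i → q ∙ f i) ≈ q ∙ (λ j → p ∙ (λ i → f i j))
  ∙-swap p q f = trans
    (sum-cong-≋ λ i → *-distribˡ-sum (p i) λ j → q j * f i j)
    (trans (∑-comm λ i j → p i * (q j * f i j))
      (sum-cong-≋ λ j → trans
        (sum-cong-≋ λ i → solve 3 (λ p q f → p :* (q :* f) := q :* (p :* f)) refl (p i) (q j) (f i j))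
        (sym (*-distribˡ-sum (q j) λ i → p i * f i j))))

  -- Farkas' lemma.

  InCone : ∀ {k d} → (Fin k → Vector Carrier d) → Vector Carrier d → Set (c ⊔ ℓ₁ ⊔ ℓ₂)
  InCone {k} a b = ∃ λ (t : Vector Carrier k) → (∀ i → 0# ≤ t i) × (∀ j → b j ≈ t ∙ (λ i → a i j))

  Separated : ∀ {k d} → (Fin k → Vector Carrier d) → Vector Carrier d → Set (c ⊔ ℓ₂)
  Separated a b = ∃ λ x → (∀ i → a i ∙ x ≤ 0#) × ¬ (b ∙ x ≤ 0#)

  -- Bartl's induction: a vector x separating all generators but the first, a₀, is used to project
  -- the remaining generators and b along a₀ onto the hyperplane orthogonal to x.
  farkas : ∀ k {d} (a : Fin k → Vector Carrier d) b → InCone a b ⊎ Separated a b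
  -- With no generators the cone is the origin: `b` lies in it if `b ∙ b ≤ 0`, and otherwise `b`
  -- itself separates.
  farkas zero a b with (b ∙ b) ≤? 0#
  ... | no  b∙b≰0 = inj₂ (b , (λ ()) , b∙b≰0)
  ... | yes b∙b≤0 = inj₁ ((λ ()) , (λ ()) , λ j →
    square≤0⇒≈0 (≤-trans (term≤sum (λ i → square-nonNegative (b i)) j) b∙b≤0))
  farkas (suc k) {d} a b with farkas k (a ∘ suc) b
  ... | inj₁ (t , 0≤t , b≈) = inj₁ (0# ∷ t , (λ { zero → ≤-refl ; (suc i) → 0≤t i }) ,
    λ j → trans (b≈ j) (sym (trans (+-congʳ (zeroˡ (a zero j))) (+-identityˡ _))))
  ... | inj₂ (x , ax≤0 , bx≰0) with (a zero ∙ x) ≤? 0#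
  ...   | yes a₀x≤0 = inj₂ (x , (λ { zero → a₀x≤0 ; (suc i) → ax≤0 i }) , bx≰0)
  ...   | no  a₀x≰0 with farkas k (λ i → project (a (suc i))) (project b)
    where
    s = proj₁ (inverse (a zero ∙ x) (≰⇒≉ a₀x≰0))
    project : Vector Carrier d → Vector Carrier d
    project e = e ⊕ (e ∙ x) * - s · a zero
  ...     | inj₁ (t , 0≤t , b′≈) = inj₁ (t₀ ∷ t , (λ { zero → 0≤t₀ ; (suc i) → 0≤t i }) , b≈)
    where
    s = proj₁ (inverse (a zero ∙ x) (≰⇒≉ a₀x≰0))
    0≤s = inverse-nonNegative (≰⇒≥ a₀x≰0) (proj₂ (inverse (a zero ∙ x) (≰⇒≉ a₀x≰0)))
    n : Vector Carrier k
    n i = (a (suc i) ∙ x) * - s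
    0≤n : ∀ i → 0# ≤ n i
    0≤n i = begin
      0#                      ≤⟨ 0≤neg (*-nonPositive 0≤s (ax≤0 i)) ⟩
      - (s * (a (suc i) ∙ x)) ≈⟨ -‿cong (*-comm s _) ⟩
      - ((a (suc i) ∙ x) * s) ≈⟨ -‿distribʳ-* _ s ⟩
      n i                     ∎
    -- Undoing the projection returns `(b ∙ x) * s` copies of the first generator for `b` and `n i`
    -- copies for each remaining generator. Both are nonnegative, since `x` is positive on `b` and
    -- at most 0 on those generators.
    t₀ = (b ∙ x) * s + t ∙ n
    0≤t₀ : 0# ≤ t₀
    0≤t₀ = ≤-trans (≤-reflexive (sym (+-identityˡ 0#)))
      (+-mono-≤ (*-nonNegative (≰⇒≥ bx≰0) 0≤s) (sum-nonNegative λ i → *-nonNegative (0≤t i) (0≤n i)))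
    b≈ : ∀ j → b j ≈ t₀ * a zero j + t ∙ (λ i → a (suc i) j)
    b≈ j = begin-equality
      b j
        ≈⟨ +-identityʳ (b j) ⟨
      b j + 0#
        ≈⟨ +-congˡ (trans (*-congʳ (trans (*-congˡ (-‿inverseʳ s)) (zeroʳ (b ∙ x)))) (zeroˡ a₀)) ⟨
      b j + (b ∙ x) * (s + - s) * a₀
        ≈⟨ solve 5 (λ b e s r a → b :+ e :* (s :+ r) :* a := (b :+ e :* r :* a) :+ e :* s :* a) refl (b j) (b ∙ x) s (- s) a₀ ⟩
      (b j + (b ∙ x) * - s * a₀) + (b ∙ x) * s * a₀
        ≈⟨ +-congʳ (b′≈ j) ⟩
      t ∙ (λ i → a (suc i) j + n i * a₀) + (b ∙ x) * s * a₀
        ≈⟨ +-congʳ (sum-cong-≋ λ i → *-congˡ (+-congˡ (*-comm (n i) a₀))) ⟩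
      t ∙ ((λ i → a (suc i) j) ⊕ a₀ · n) + (b ∙ x) * s * a₀
        ≈⟨ +-congʳ (∙-⊕ʳ t _ a₀ n) ⟩
      t ∙ (λ i → a (suc i) j) + a₀ * (t ∙ n) + (b ∙ x) * s * a₀
        ≈⟨ solve 4 (λ u a v e → u :+ a :* v :+ e :* a := (e :+ v) :* a :+ u) refl _ a₀ (t ∙ n) ((b ∙ x) * s) ⟩
      t₀ * a₀ + t ∙ (λ i → a (suc i) j) ∎
      where a₀ = a zero j
  ...     | inj₂ (y , a′y≤0 , b′y≰0) = inj₂ (z ,
    (λ { zero    → ≤-reflexive a₀z≈0
       ; (suc i) → ≤-trans (≤-reflexive (pair (a (suc i)))) (a′y≤0 i) }) ,
    λ bz≤0 → b′y≰0 (≤-trans (≤-reflexive (sym (pair b))) bz≤0))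
    where
    s = proj₁ (inverse (a zero ∙ x) (≰⇒≉ a₀x≰0))
    sinv = proj₂ (inverse (a zero ∙ x) (≰⇒≉ a₀x≰0))
    -- The adjoint of the projection, applied to `y`: pairing `e` with `z` is pairing the projected
    -- `e` with `y`, so the inequalities for `y` carry over, and `z` is orthogonal to the first
    -- generator.
    z = y ⊕ (a zero ∙ y) * - s · x
    pair : ∀ e → e ∙ z ≈ (e ⊕ (e ∙ x) * - s · a zero) ∙ y
    pair e = begin-equality
      e ∙ z
        ≈⟨ ∙-⊕ʳ e y _ x ⟩
      e ∙ y + (a zero ∙ y) * - s * (e ∙ x)
        ≈⟨ +-congˡ (solve 3 (λ u r v → u :* r :* v := v :* r :* u) refl (a zero ∙ y) (- s) (e ∙ x)) ⟩
      e ∙ y + (e ∙ x) * - s * (a zero ∙ y)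
        ≈⟨ ∙-⊕ˡ e _ (a zero) y ⟨
      (e ⊕ (e ∙ x) * - s · a zero) ∙ y ∎
    a₀z≈0 : a zero ∙ z ≈ 0#
    a₀z≈0 = begin-equality
      a zero ∙ z
        ≈⟨ ∙-⊕ʳ (a zero) y _ x ⟩
      u + u * - s * (a zero ∙ x)
        ≈⟨ +-congˡ (solve 3 (λ u r v → u :* r :* v := u :* (v :* r)) refl u (- s) (a zero ∙ x)) ⟩
      u + u * ((a zero ∙ x) * - s)
        ≈⟨ +-congˡ (*-congˡ (trans (sym (-‿distribʳ-* _ s)) (-‿cong sinv))) ⟩
      u + u * - 1#
        ≈⟨ +-congˡ (trans (sym (-‿distribʳ-* u 1#)) (-‿cong (*-identityʳ u))) ⟩
      u + - u
        ≈⟨ -‿inverseʳ u ⟩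
      0# ∎
      where u = a zero ∙ y

  -- Further dot product rules and the inequality form of Farkas' lemma.

  ∙-neg : ∀ {n} (a f : Vector Carrier n) → a ∙ (λ i → - f i) ≈ - (a ∙ f)
  ∙-neg a f = trans (sum-cong-≋ λ i → sym (-‿distribʳ-* (a i) (f i))) (sum-neg λ i → a i * f i)

  ∙-zeroʳ : ∀ {n} (a : Vector Carrier n) → a ∙ (λ _ → 0#) ≈ 0#
  ∙-zeroʳ a = sum-zero λ i → zeroʳ (a i)

  ∙-oneʳ : ∀ {n} (a : Vector Carrier n) → a ∙ (λ _ → 1#) ≈ sum a
  ∙-oneʳ a = sum-cong-≋ λ i → *-identityʳ (a i)

  sum-δ : ∀ {n} (i : Fin n) → sum (δ i) ≈ 1#
  sum-δ i = trans (sym (∙-oneʳ (δ i))) (δ-∙ i λ _ → 1#)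

  ∙-constʳ : ∀ {n} (a : Vector Carrier n) t → a ∙ (λ _ → t) ≈ t * sum a
  ∙-constʳ a t = trans (∙-comm a _) (sym (*-distribˡ-sum t a))

  ∙-congʳ : ∀ {n} (a : Vector Carrier n) {f g} → (∀ i → f i ≈ g i) → a ∙ f ≈ a ∙ g
  ∙-congʳ a f≈g = sum-cong-≋ λ i → *-congˡ (f≈g i)

  ∙-monoʳ-≤ : ∀ {n} {a f g : Vector Carrier n} → (∀ i → 0# ≤ a i) → (∀ i → f i ≤ g i) → a ∙ f ≤ a ∙ g
  ∙-monoʳ-≤ 0≤a f≤g = sum-mono-≤ λ i → *-monoˡ-≤ (0≤a i) (f≤g i)

  ∙-scaleʳ : ∀ {n} (a : Vector Carrier n) t f → a ∙ (λ i → t * f i) ≈ t * (a ∙ f)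
  ∙-scaleʳ a t f = trans
    (sum-cong-≋ λ i → solve 3 (λ a t f → a :* (t :* f) := t :* (a :* f)) refl (a i) t (f i))
    (sym (*-distribˡ-sum t λ i → a i * f i))

  -- The map `φ` lets one statement cover concatenated scalars, with `φ` the identity, and
  -- concatenated families of generators, with `φ` reading off a coordinate.
  ∙-++ : ∀ {ℓ} {A : Set ℓ} {m n} (φ : A → Carrier) (z : Vector Carrier (m ℕ.+ n)) (P : Vector A m) (Q : Vector A n) →
         z ∙ (λ l → φ ((P ++ Q) l)) ≈ (λ i → z (i ↑ˡ n)) ∙ (φ ∘ P) + (λ j → z (m ↑ʳ j)) ∙ (φ ∘ Q)
  ∙-++ {m = m} φ z P Q = trans (sum-split m _) (+-cong
    (sum-cong-≋ λ i → *-congˡ (reflexive (≡.cong φ (lookup-++ˡ P Q i))))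
    (sum-cong-≋ λ j → *-congˡ (reflexive (≡.cong φ (lookup-++ʳ P Q j)))))

  -- Negated unit vectors are adjoined as slack generators. Nonnegative multiples of them only lower
  -- coordinates, which turns equalities into inequalities; on the other side, a separating `x` must
  -- satisfy `- x j ≤ 0`.
  farkas-≥ : ∀ {k d} (M : Fin k → Vector Carrier d) b →
             (∃ λ z → (∀ i → 0# ≤ z i) × (∀ j → b j ≤ z ∙ (λ i → M i j))) ⊎
             (∃ λ x → (∀ j → 0# ≤ x j) × (∀ i → M i ∙ x ≤ 0#) × ¬ (b ∙ x ≤ 0#))
  farkas-≥ {k} {d} M b with farkas (k ℕ.+ d) (M ++ slack) b
    where
    slack : Fin d → Vector Carrier d
    slack l j = - δ l j
  ... | inj₁ (t , 0≤t , b≈) = inj₁ (z , (λ i → 0≤t (i ↑ˡ d)) , λ j → begin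
    b j
      ≈⟨ trans (b≈ j) (∙-++ (λ a → a j) t M _) ⟩
    z ∙ (λ i → M i j) + (λ l → t (k ↑ʳ l)) ∙ (λ l → - δ l j)
      ≤⟨ +-mono-≤ ≤-refl (sum-nonPositive λ l → *-nonPositive (0≤t (k ↑ʳ l)) (neg-≤0 (δ-nonNegative l j))) ⟩
    z ∙ (λ i → M i j) + 0#
      ≈⟨ +-identityʳ _ ⟩
    z ∙ (λ i → M i j) ∎)
    where
    z : Vector Carrier k
    z i = t (i ↑ˡ d)
  ... | inj₂ (x , ax≤0 , bx≰0) = inj₂ (x , 0≤x , Mx≤0 , bx≰0)
    where
    Mx≤0 : ∀ i → M i ∙ x ≤ 0#
    Mx≤0 i = ≡.subst (λ a → a ∙ x ≤ 0#) (lookup-++ˡ M _ i) (ax≤0 (i ↑ˡ d))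
    0≤x : ∀ j → 0# ≤ x j
    0≤x j = x-y≤0⇒x≤y (begin
      0# + - x j                ≈⟨ +-identityˡ (- x j) ⟩
      - x j                     ≈⟨ -‿cong (trans (∙-comm x (δ j)) (δ-∙ j x)) ⟨
      - (x ∙ δ j)               ≈⟨ trans (∙-comm _ x) (∙-neg x (δ j)) ⟨
      (λ l → - δ j l) ∙ x       ≤⟨ ≡.subst (λ a → a ∙ x ≤ 0#) (lookup-++ʳ M _ j) (ax≤0 (k ↑ʳ j)) ⟩
      0#                        ∎)

  -- Linear programming duality.

  module Duality {m n} (G : Fin m → Fin n → Carrier) (G≰0 : ∀ i j → ¬ (G i j ≤ 0#))
                 (h : Vector Carrier n) (0≤h : ∀ j → 0# ≤ h j) (j₀ : Fin n) where

    -- One coordinate per inequality of the system to be solved: first `q ∙ h ≤ sum p`, then the `m`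
    -- rows of Gq ≥ 1, then the `n` columns of pG ≤ h with signs reversed. `primalColumn i` and
    -- `dualColumn j` hold the coefficients of the unknowns `p i` and `q j`.
    block : Carrier → Vector Carrier m → Vector Carrier n → Vector Carrier (suc (m ℕ.+ n))
    block t u v = t ∷ (u ++ v)

    primalColumn : Fin m → Vector Carrier (suc (m ℕ.+ n))
    primalColumn i = block 1# (λ _ → 0#) (λ j → - G i j)

    dualColumn : Fin n → Vector Carrier (suc (m ℕ.+ n))
    dualColumn j = block (- h j) (λ i → G i j) (λ _ → 0#)

    bound : Vector Carrier (suc (m ℕ.+ n))
    bound = block 0# (λ _ → 1#) (λ j → - h j)

    block-∙ : ∀ t a b x → block t a b ∙ x ≈ t * x zero + ((λ i → x (suc (i ↑ˡ n))) ∙ a + (λ j → x (suc (m ↑ʳ j))) ∙ b)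
    block-∙ t a b x = +-congˡ (trans (∙-comm (a ++ b) (x ∘ suc)) (∙-++ (λ y → y) (x ∘ suc) a b))

    -- Excludes the separating alternative of Farkas' lemma, whose vector splits into `τ`, `u` and
    -- `v`. For positive `τ` this is homogenised weak duality: the form uGv lies between `τ * sum u`
    -- and `τ * (v ∙ h)`.
    weakDuality : ∀ τ (u : Vector Carrier m) (v : Vector Carrier n) → 0# ≤ τ → (∀ i → 0# ≤ u i) → (∀ j → 0# ≤ v j) →
                 (∀ i → τ ≤ v ∙ G i) → (∀ j → u ∙ (λ i → G i j) ≤ τ * h j) → sum u ≤ v ∙ h
    weakDuality τ u v 0≤τ 0≤u 0≤v τ≤Gv uG≤τh with τ ≤? 0#
    ... | no τ≰0 = *-cancelˡ-≤ τ≰0 (begin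
      τ * sum u                        ≈⟨ ∙-constʳ u τ ⟨
      u ∙ (λ _ → τ)                    ≤⟨ ∙-monoʳ-≤ 0≤u τ≤Gv ⟩
      u ∙ (λ i → v ∙ G i)              ≈⟨ ∙-swap u v G ⟩
      v ∙ (λ j → u ∙ (λ i → G i j))    ≤⟨ ∙-monoʳ-≤ 0≤v uG≤τh ⟩
      v ∙ (λ j → τ * h j)              ≈⟨ ∙-scaleʳ v τ h ⟩
      τ * (v ∙ h)                      ∎)
    -- In the degenerate case column `j₀` of uG is at most 0, and positivity of `G` forces every
    -- `u i` to be at most 0, while `v ∙ h` is nonnegative.
    ... | yes τ≤0 = ≤-trans (sum-nonPositive u≤0) (sum-nonNegative λ j → *-nonNegative (0≤v j) (0≤h j))
      where
      u≤0 : ∀ i → u i ≤ 0#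
      u≤0 i = *-≤0⇒≤0 (G≰0 i j₀) (begin
        G i j₀ * u i            ≈⟨ *-comm (G i j₀) (u i) ⟩
        u i * G i j₀            ≤⟨ term≤sum (λ i → *-nonNegative (0≤u i) (≰⇒≥ (G≰0 i j₀))) i ⟩
        u ∙ (λ i → G i j₀)      ≤⟨ uG≤τh j₀ ⟩
        τ * h j₀                ≈⟨ *-comm τ (h j₀) ⟩
        h j₀ * τ                ≤⟨ *-nonPositive (0≤h j₀) τ≤0 ⟩
        0#                      ∎)

    -- The linear programs max Σp subject to pG ≤ h and min q·h subject to Gq ≥ 1 are dual;
    -- q·h ≤ Σp, the reverse of weak duality, makes p and q optimal.
    duality : ∃ λ (p : Vector Carrier m) → ∃ λ (q : Vector Carrier n) →
              (∀ i → 0# ≤ p i) × (∀ j → 0# ≤ q j) ×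
              (∀ j → p ∙ (λ i → G i j) ≤ h j) × (∀ i → 1# ≤ q ∙ G i) × q ∙ h ≤ sum p
    duality with farkas-≥ (primalColumn ++ dualColumn) bound
    ... | inj₁ (z , 0≤z , b≤) = p , q , (λ i → 0≤z (i ↑ˡ n)) , (λ j → 0≤z (m ↑ʳ j)) ,
      (λ j → -x≤-y⇒y≤x (begin
        - h j
          ≡⟨ lookup-++ʳ {m = m} (λ _ → 1#) (λ j → - h j) j ⟨
        bound (suc (m ↑ʳ j))
          ≤⟨ row (suc (m ↑ʳ j)) ⟩
        p ∙ (λ i → primalColumn i (suc (m ↑ʳ j))) + q ∙ (λ j′ → dualColumn j′ (suc (m ↑ʳ j)))
          ≈⟨ +-cong (∙-congʳ p λ i → reflexive (lookup-++ʳ {m = m} (λ _ → 0#) (λ j → - G i j) j))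
                    (∙-congʳ q λ j′ → reflexive (lookup-++ʳ {m = m} (λ i → G i j′) (λ _ → 0#) j)) ⟩
        p ∙ (λ i → - G i j) + q ∙ (λ _ → 0#)
          ≈⟨ trans (+-cong (∙-neg p _) (∙-zeroʳ q)) (+-identityʳ _) ⟩
        - (p ∙ (λ i → G i j)) ∎)) ,
      (λ i → begin
        1#
          ≡⟨ lookup-++ˡ (λ _ → 1#) (λ j → - h j) i ⟨
        bound (suc (i ↑ˡ n))
          ≤⟨ row (suc (i ↑ˡ n)) ⟩
        p ∙ (λ i′ → primalColumn i′ (suc (i ↑ˡ n))) + q ∙ (λ j → dualColumn j (suc (i ↑ˡ n)))
          ≈⟨ +-cong (∙-congʳ p λ i′ → reflexive (lookup-++ˡ (λ _ → 0#) (λ j → - G i′ j) i))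
                    (∙-congʳ q λ j → reflexive (lookup-++ˡ (λ i → G i j) (λ _ → 0#) i)) ⟩
        p ∙ (λ _ → 0#) + q ∙ G i
          ≈⟨ trans (+-congʳ (∙-zeroʳ p)) (+-identityˡ _) ⟩
        q ∙ G i ∎) ,
      +-cancelʳ-≤ (- (q ∙ h)) (begin
        q ∙ h + - (q ∙ h)                   ≈⟨ -‿inverseʳ (q ∙ h) ⟩
        0#                                  ≤⟨ row zero ⟩
        p ∙ (λ _ → 1#) + q ∙ (λ j → - h j)  ≈⟨ +-cong (∙-oneʳ p) (∙-neg q h) ⟩
        sum p + - (q ∙ h)                   ∎)
      where
      p : Vector Carrier m
      p i = z (i ↑ˡ n)
      q : Vector Carrier n
      q j = z (m ↑ʳ j)
      row : ∀ l → bound l ≤ p ∙ (λ i → primalColumn i l) + q ∙ (λ j → dualColumn j l)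
      row l = ≤-trans (b≤ l) (≤-reflexive (∙-++ (λ a → a l) z primalColumn dualColumn))
    -- A separating vector would make `sum u` exceed `v ∙ h`, against `weakDuality`; its pairings
    -- with the columns are exactly the hypotheses of that lemma.
    ... | inj₂ (x , 0≤x , Mx≤0 , bx≰0) = contradiction (begin
      bound ∙ x
        ≈⟨ block-∙ 0# _ _ x ⟩
      0# * τ + (u ∙ (λ _ → 1#) + v ∙ (λ j → - h j))
        ≈⟨ trans (+-cong (zeroˡ τ) (+-cong (∙-oneʳ u) (∙-neg v h))) (+-identityˡ _) ⟩
      sum u + - (v ∙ h)
        ≤⟨ +-mono-≤ (weakDuality τ u v (0≤x zero) (λ i → 0≤x (suc (i ↑ˡ n))) (λ j → 0≤x (suc (m ↑ʳ j))) τ≤Gv uG≤τh) ≤-refl ⟩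
      v ∙ h + - (v ∙ h)
        ≈⟨ -‿inverseʳ (v ∙ h) ⟩
      0# ∎) bx≰0
      where
      τ = x zero
      u : Vector Carrier m
      u i = x (suc (i ↑ˡ n))
      v : Vector Carrier n
      v j = x (suc (m ↑ʳ j))
      τ≤Gv : ∀ i → τ ≤ v ∙ G i
      τ≤Gv i = x-y≤0⇒x≤y (begin
        τ + - (v ∙ G i)
          ≈⟨ +-cong (*-identityˡ τ) (trans (+-cong (∙-zeroʳ u) (∙-neg v (G i))) (+-identityˡ _)) ⟨
        1# * τ + (u ∙ (λ _ → 0#) + v ∙ (λ j → - G i j))
          ≈⟨ block-∙ 1# _ _ x ⟨
        primalColumn i ∙ x
          ≤⟨ ≡.subst (λ a → a ∙ x ≤ 0#) (lookup-++ˡ primalColumn dualColumn i) (Mx≤0 (i ↑ˡ n)) ⟩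
        0# ∎)
      uG≤τh : ∀ j → u ∙ (λ i → G i j) ≤ τ * h j
      uG≤τh j = x-y≤0⇒x≤y (begin
        u ∙ (λ i → G i j) + - (τ * h j)
          ≈⟨ +-comm _ _ ⟩
        - (τ * h j) + u ∙ (λ i → G i j)
          ≈⟨ +-cong (trans (-‿cong (*-comm τ (h j))) (-‿distribˡ-* (h j) τ)) (trans (sym (+-identityʳ _)) (+-congˡ (sym (∙-zeroʳ v)))) ⟩
        - h j * τ + (u ∙ (λ i → G i j) + v ∙ (λ _ → 0#))
          ≈⟨ block-∙ (- h j) _ _ x ⟨
        dualColumn j ∙ x
          ≤⟨ ≡.subst (λ a → a ∙ x ≤ 0#) (lookup-++ʳ primalColumn dualColumn j) (Mx≤0 (m ↑ʳ j)) ⟩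
        0# ∎)

-- Division and sums in the extended reals.

module Expectations {c ℓ₁ ℓ₂} (ℝ : Reals c ℓ₁ ℓ₂) where
  open OrderedField ℝ
  open Extended ℝ

  private
    module ≤⁺ = IsTotalOrder (≤⁺-isTotalOrder _≤_ isTotalOrder)

  ≤⁺-totalOrder : TotalOrder c (c ⊔ ℓ₁) (c ⊔ ℓ₂)
  ≤⁺-totalOrder = record { isTotalOrder = ≤⁺-isTotalOrder _≤_ isTotalOrder }

  open Extrema ≤⁺-totalOrder using (argmin; argmax; f[argmin]≤f[xs]; f[xs]≤f[argmax])

  ÷-zero : ∀ a {b} → b ≈ 0# → a ÷ b ≡ ⊤⁺
  ÷-zero a {b} b≈0 with b ≟ 0#
  ... | yes _   = ≡.refl
  ... | no  b≉0 = contradiction b≈0 b≉0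

  -- Inverses are unique, so any inverse of `b` can stand in for the one chosen by `inverse`.
  ÷-inverse : ∀ a {b y} → b * y ≈ 1# → a ÷ b ≈⁺ [ a * y ]
  ÷-inverse a {b} {y} by≈1 with b ≟ 0#
  ... | yes b≈0 = contradiction (trans (sym (zeroˡ y)) (trans (*-congʳ (sym b≈0)) by≈1)) 0≉1
  ... | no  b≉0 = [ *-congˡ (begin-equality
    z            ≈⟨ *-identityʳ z ⟨
    z * 1#       ≈⟨ *-congˡ by≈1 ⟨
    z * (b * y)  ≈⟨ solve 3 (λ z b y → z :* (b :* y) := (b :* z) :* y) refl z b y ⟩
    (b * z) * y  ≈⟨ *-congʳ (proj₂ (inverse b b≉0)) ⟩
    1# * y       ≈⟨ *-identityˡ y ⟩
    y            ∎) ]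
    where z = proj₁ (inverse b b≉0)

  ÷-cong : ∀ {a a′ b b′} → a ≈ a′ → b ≈ b′ → a ÷ b ≈⁺ a′ ÷ b′
  ÷-cong {a} {a′} {b} {b′} a≈a′ b≈b′ with b ≟ 0#
  ... | yes b≈0 = ≤⁺.Eq.reflexive (≡.sym (÷-zero a′ (trans (sym b≈b′) b≈0)))
  ... | no  b≉0 = ≤⁺.Eq.trans [ *-congʳ a≈a′ ]
    (≤⁺.Eq.sym (÷-inverse a′ (trans (*-congʳ (sym b≈b′)) (proj₂ (inverse b b≉0)))))

  ÷-monoˡ-≤ : ∀ {a a′ b} → 0# ≤ b → a ≤ a′ → a ÷ b ≤⁺ a′ ÷ b
  ÷-monoˡ-≤ {a} {a′} {b} 0≤b a≤a′ with b ≟ 0#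
  ... | yes _   = ⊤⁺ ≤⊤⁺
  ... | no  b≉0 = [ begin
    a * y   ≈⟨ *-comm a y ⟩
    y * a   ≤⟨ *-monoˡ-≤ (inverse-nonNegative 0≤b (proj₂ (inverse b b≉0))) a≤a′ ⟩
    y * a′  ≈⟨ *-comm y a′ ⟩
    a′ * y  ∎ ]
    where y = proj₁ (inverse b b≉0)

  *÷-cancel : ∀ t {b} → ¬ (b ≈ 0#) → (t * b) ÷ b ≈⁺ [ t ]
  *÷-cancel t {b} b≉0 = ≤⁺.Eq.trans (÷-inverse (t * b) by≈1)
    [ trans (*-assoc t b _) (trans (*-congˡ by≈1) (*-identityʳ t)) ]
    where by≈1 = proj₂ (inverse b b≉0)

  ≤⇒÷≤ : ∀ {a b t} → 0# ≤ b → ¬ (b ≈ 0#) → a ≤ t * b → a ÷ b ≤⁺ [ t ]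
  ≤⇒÷≤ {t = t} 0≤b b≉0 a≤tb = ≤⁺.trans (÷-monoˡ-≤ 0≤b a≤tb) (≤⁺.reflexive (*÷-cancel t b≉0))

  -- For `b ≈ 0#` the quotient is `⊤⁺`, above every finite `t`; hence, unlike `≤⇒÷≤`, this holds for
  -- zero denominators too.
  ≤⇒≤÷ : ∀ {a b t} → 0# ≤ b → t * b ≤ a → [ t ] ≤⁺ a ÷ b
  ≤⇒≤÷ {a} {b} {t} 0≤b tb≤a = byCases (b ≟ 0#)
    where
    byCases : Dec (b ≈ 0#) → [ t ] ≤⁺ a ÷ b
    byCases (yes b≈0) = ≡.subst ([ t ] ≤⁺_) (≡.sym (÷-zero a b≈0)) ([ t ] ≤⊤⁺)
    byCases (no  b≉0) = ≤⁺.trans (≤⁺.reflexive (≤⁺.Eq.sym (*÷-cancel t b≉0))) (÷-monoˡ-≤ 0≤b tb≤a)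

  -- A finite bound on the quotient rules out a zero denominator, where the quotient would be `⊤⁺`.
  ÷≤⇒≤ : ∀ {a b t} → 0# ≤ b → a ÷ b ≤⁺ [ t ] → ¬ (b ≈ 0#) × a ≤ t * b
  ÷≤⇒≤ {a} {b} {t} 0≤b a÷b≤t with b ≟ 0#
  ÷≤⇒≤ {a} {b} {t} 0≤b ()      | yes _
  ÷≤⇒≤ {a} {b} {t} 0≤b [ ay≤t ] | no b≉0 = b≉0 , (begin
    a            ≈⟨ *-identityʳ a ⟨
    a * 1#       ≈⟨ *-congˡ (proj₂ (inverse b b≉0)) ⟨
    a * (b * y)  ≈⟨ solve 3 (λ a b y → a :* (b :* y) := b :* (a :* y)) refl a b y ⟩
    b * (a * y)  ≤⟨ *-monoˡ-≤ 0≤b ay≤t ⟩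
    b * t        ≈⟨ *-comm b t ⟩
    t * b        ∎)
    where y = proj₁ (inverse b b≉0)

  ·⁺-⊤⁺ : ∀ {w} → ¬ (w ≈ 0#) → w ·⁺ ⊤⁺ ≡ ⊤⁺
  ·⁺-⊤⁺ {w} w≉0 with w ≟ 0#
  ... | yes w≈0 = contradiction w≈0 w≉0
  ... | no  _   = ≡.refl

  ·⁺-cong-[] : ∀ w {e x} → e ≈⁺ [ x ] → w ·⁺ e ≈⁺ [ w * x ]
  ·⁺-cong-[] w [ e≈x ] = [ *-congˡ e≈x ]

  foldr-+⁺-⊤⁺ : ∀ {n} (f : Vector ℝ∞ n) i → f i ≡ ⊤⁺ → foldr _+⁺_ [ 0# ] f ≡ ⊤⁺
  foldr-+⁺-⊤⁺ f zero    fi≡⊤ rewrite fi≡⊤ = ≡.refl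
  foldr-+⁺-⊤⁺ f (suc i) fi≡⊤ rewrite foldr-+⁺-⊤⁺ (f ∘ suc) i fi≡⊤ with f zero
  ... | [ _ ] = ≡.refl
  ... | ⊤⁺    = ≡.refl

  foldr-+⁺-[] : ∀ {n} (f : Vector ℝ∞ n) {r : Vector Carrier n} → (∀ i → f i ≈⁺ [ r i ]) →
                foldr _+⁺_ [ 0# ] f ≈⁺ [ sum r ]
  foldr-+⁺-[] {zero}  f f≈r = [ refl ]
  foldr-+⁺-[] {suc n} f f≈r with f zero | f≈r zero | foldr _+⁺_ [ 0# ] (f ∘ suc) | foldr-+⁺-[] (f ∘ suc) (f≈r ∘ suc)
  ... | _ | [ p ] | _ | [ q ] = [ +-cong p q ]

  -- Extrema, normalised weights and point masses on a finite set.

  module _ {a} (U : FiniteSet a) where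
    open FiniteSet U using (size; element; enumeration)
    open Inverse enumeration using (from; strictlyInverseˡ; strictlyInverseʳ)

    index : Element U → Fin size
    index = from

    ∀-element : ∀ {ℓ} (P : Element U → Set ℓ) → (∀ i → P (element i)) → ∀ u → P u
    ∀-element P Pelement u = ≡.subst P (strictlyInverseˡ u) (Pelement (from u))

    minimiser : Element U → (f : Element U → ℝ∞) → ∃ λ u → ∀ w → f u ≤⁺ f w
    minimiser u₀ f = argmin f u₀ (tabulate element) , ∀-element _ λ i →
      All.lookup (f[argmin]≤f[xs] {f = f} u₀ (tabulate element)) (∈-tabulate⁺ {f = element} i)

    maximiser : Element U → (f : Element U → ℝ∞) → ∃ λ u → ∀ w → f w ≤⁺ f u
    maximiser u₀ f = argmax f u₀ (tabulate element) , ∀-element _ λ i →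
      All.lookup (f[xs]≤f[argmax] {f = f} u₀ (tabulate element)) (∈-tabulate⁺ {f = element} i)

    normalise : ∀ (w : Vector Carrier size) t → (∀ i → 0# ≤ w i) → 0# ≤ t → sum w * t ≈ 1# → Δ U
    normalise w t 0≤w 0≤t wt≈1 = record
      { mass        = λ u → w (from u) * t
      ; nonNegative = λ u → *-nonNegative (0≤w (from u)) 0≤t
      ; total       = trans (sum-cong-≋ λ i → *-congʳ (reflexive (≡.cong w (strictlyInverseʳ i))))
                            (trans (sym (*-distribʳ-sum t w)) wt≈1)
      }

    𝔼-normalise : ∀ w t 0≤w 0≤t wt≈1 f → 𝔼 (normalise w t 0≤w 0≤t wt≈1) f ≈ t * (w ∙ (f ∘ element))
    𝔼-normalise w t _ _ _ f = trans
      (sum-cong-≋ λ i → trans (*-congʳ (*-congʳ (reflexive (≡.cong w (strictlyInverseʳ i)))))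
        (solve 3 (λ w t f → w :* t :* f := t :* (w :* f)) refl (w i) t (f (element i))))
      (sym (*-distribˡ-sum t λ i → w i * f (element i)))

    point : Element U → Δ U
    point u = normalise (δ (from u)) 1# (δ-nonNegative (from u)) 0≤1 (trans (*-identityʳ _) (sum-δ (from u)))

    𝔼-point : ∀ u f → 𝔼 (point u) f ≈ f u
    𝔼-point u f = trans (𝔼-normalise (δ (from u)) 1# (δ-nonNegative (from u)) 0≤1 (trans (*-identityʳ _) (sum-δ (from u))) f) (trans (*-identityˡ _)
      (trans (δ-∙ (from u) (f ∘ element)) (reflexive (≡.cong f (strictlyInverseˡ u)))))

    -- Since 0 · (+∞) = 0, an infinite ratio makes the mean infinite only at a point of nonzero
    -- mass.
    mass-point≉0 : ∀ u → ¬ (mass (point u) u ≈ 0#)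
    mass-point≉0 u δ≈0 = 0≉1 (trans (sym δ≈0) (trans (*-identityʳ _) (δ-diagonal (from u))))
      where
      δ-diagonal : ∀ {n} (i : Fin n) → δ i i ≈ 1#
      δ-diagonal zero    = refl
      δ-diagonal (suc i) = δ-diagonal i

  -- Properties of expectations.

  module _ {a} {U : FiniteSet a} (p : Δ U) where
    open FiniteSet U using (element)

    𝔼-cong : ∀ {f f′} → (∀ u → f u ≈ f′ u) → 𝔼 p f ≈ 𝔼 p f′
    𝔼-cong f≈f′ = ∙-congʳ (mass p ∘ element) (f≈f′ ∘ element)

    𝔼-mono-≤ : ∀ {f f′} → (∀ u → f u ≤ f′ u) → 𝔼 p f ≤ 𝔼 p f′
    𝔼-mono-≤ f≤f′ = ∙-monoʳ-≤ (Δ.nonNegative p ∘ element) (f≤f′ ∘ element)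

    𝔼-const : ∀ t → 𝔼 p (λ _ → t) ≈ t
    𝔼-const t = trans (∙-constʳ (mass p ∘ element) t) (trans (*-congˡ (Δ.total p)) (*-identityʳ t))

    𝔼-scale : ∀ t f → 𝔼 p (λ u → t * f u) ≈ t * 𝔼 p f
    𝔼-scale t f = ∙-scaleʳ (mass p ∘ element) t (f ∘ element)

    ≤𝔼 : ∀ {t f} → (∀ u → t ≤ f u) → t ≤ 𝔼 p f
    ≤𝔼 {t} t≤f = ≤-trans (≤-reflexive (sym (𝔼-const t))) (𝔼-mono-≤ t≤f)

    𝔼≤ : ∀ {t f} → (∀ u → f u ≤ t) → 𝔼 p f ≤ t
    𝔼≤ {t} f≤t = ≤-trans (𝔼-mono-≤ f≤t) (≤-reflexive (𝔼-const t))

    𝔼-nonNegative : ∀ {f} → (∀ u → 0# ≤ f u) → 0# ≤ 𝔼 p f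
    𝔼-nonNegative = ≤𝔼

    -- If the mean were at most 0, so would be each of its nonnegative terms, hence each mass,
    -- against total mass 1.
    𝔼-positive : ∀ {f} → (∀ u → ¬ (f u ≤ 0#)) → ¬ (𝔼 p f ≤ 0#)
    𝔼-positive {f} f≰0 𝔼≤0 = 1≰0 (≤-trans (≤-reflexive (sym (Δ.total p))) (sum-nonPositive λ i →
      *-≤0⇒≤0 (f≰0 (element i)) (≤-trans (≤-reflexive (*-comm _ _)) (≤-trans
        (term≤sum (λ i → *-nonNegative (Δ.nonNegative p (element i)) (≰⇒≥ (f≰0 (element i)))) i) 𝔼≤0))))

    𝔼⁺-[] : ∀ {f r} → (∀ u → f u ≈⁺ [ r u ]) → 𝔼⁺ p f ≈⁺ [ 𝔼 p r ]
    𝔼⁺-[] f≈r = foldr-+⁺-[] _ λ i → ·⁺-cong-[] (mass p (element i)) (f≈r (element i))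

    𝔼⁺-⊤⁺ : ∀ {f} i → ¬ (mass p (element i) ≈ 0#) → f (element i) ≡ ⊤⁺ → 𝔼⁺ p f ≡ ⊤⁺
    𝔼⁺-⊤⁺ i mass≉0 fi≡⊤ = foldr-+⁺-⊤⁺ _ i (≡.trans (≡.cong (mass p (element i) ·⁺_) fi≡⊤) (·⁺-⊤⁺ mass≉0))

    -- A finite bound `[ t ]` forces every `h u` to be positive, and averaging `s u ≤ t * h u` gives
    -- the claim; the bound `⊤⁺` is trivial.
    mediant-≤ : ∀ {s h} → (∀ u → 0# ≤ h u) → ∀ {v} → (∀ u → s u ÷ h u ≤⁺ v) → 𝔼 p s ÷ 𝔼 p h ≤⁺ v
    mediant-≤ 0≤h {⊤⁺}    _      = _ ≤⊤⁺
    mediant-≤ {s} {h} 0≤h {[ t ]} s÷h≤t = ≤⇒÷≤ (𝔼-nonNegative 0≤h) (≰⇒≉ (𝔼-positive h≰0)) (begin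
      𝔼 p s                ≤⟨ 𝔼-mono-≤ (λ u → proj₂ (÷≤⇒≤ (0≤h u) (s÷h≤t u))) ⟩
      𝔼 p (λ u → t * h u)  ≈⟨ 𝔼-scale t h ⟩
      t * 𝔼 p h            ∎)
      where
      h≰0 : ∀ u → ¬ (h u ≤ 0#)
      h≰0 u h≤0 = proj₁ (÷≤⇒≤ (0≤h u) (s÷h≤t u)) (≤-antisym h≤0 (0≤h u))

  module _ {a b} {X : FiniteSet a} {Y : FiniteSet b} (p : Δ X) (q : Δ Y) where
    open FiniteSet using (element)

    𝔼-swap : ∀ (f : Element X → Element Y → Carrier) → 𝔼 p (λ x → 𝔼 q (f x)) ≈ 𝔼 q (λ y → 𝔼 p (λ x → f x y))
    𝔼-swap f = ∙-swap (mass p ∘ element X) (mass q ∘ element Y) λ i j → f (element X i) (element Y j)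

    𝔼₂-𝔼ˡ : ∀ f → 𝔼₂ p q f ≈ 𝔼 p (λ x → 𝔼 q (f x))
    𝔼₂-𝔼ˡ f = sum-cong-≋ λ i → trans
      (sum-cong-≋ λ j → *-assoc (mass p (element X i)) (mass q (element Y j)) (f (element X i) (element Y j)))
      (sym (*-distribˡ-sum (mass p (element X i)) λ j → mass q (element Y j) * f (element X i) (element Y j)))

    𝔼₂-𝔼ʳ : ∀ f → 𝔼₂ p q f ≈ 𝔼 q (λ y → 𝔼 p (λ x → f x y))
    𝔼₂-𝔼ʳ f = trans (𝔼₂-𝔼ˡ f) (𝔼-swap f)

  -- Criteria for max-min and min-max values.

  module _ {a b} {A : Set a} {B : Set b} {F : A → B → ℝ∞} {v : ℝ∞} where

    -- One reply per `x` with `F x y ≤⁺ v` caps all inner minima, and the guarantee at `x*` makes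
    -- its inner minimum equal to `v` by antisymmetry.
    isMaxMin : (∀ x → ∃ λ y₀ → ∀ y → F x y₀ ≤⁺ F x y) →
               (∃ λ x → ∀ y → v ≤⁺ F x y) → (∀ x → ∃ λ y → F x y ≤⁺ v) → IsMaxMin F v
    isMaxMin inner (x* , v≤F) F≤v = m , (λ x → (proj₁ (inner x) , ≤⁺.Eq.refl) , proj₂ (inner x)) ,
      (x* , ≤⁺.antisym (m≤v x*) (v≤F (proj₁ (inner x*)))) , m≤v
      where
      m : A → ℝ∞
      m x = F x (proj₁ (inner x))
      m≤v : ∀ x → m x ≤⁺ v
      m≤v x = ≤⁺.trans (proj₂ (inner x) (proj₁ (F≤v x))) (proj₂ (F≤v x))

    isMinMax : (∀ x → ∃ λ y₀ → ∀ y → F x y ≤⁺ F x y₀) →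
               (∃ λ x → ∀ y → F x y ≤⁺ v) → (∀ x → ∃ λ y → v ≤⁺ F x y) → IsMinMax F v
    isMinMax inner (x* , F≤v) v≤F = m , (λ x → (proj₁ (inner x) , ≤⁺.Eq.refl) , proj₂ (inner x)) ,
      (x* , ≤⁺.antisym (F≤v (proj₁ (inner x*))) (v≤m x*)) , v≤m
      where
      m : A → ℝ∞
      m x = F x (proj₁ (inner x))
      v≤m : ∀ x → v ≤⁺ m x
      v≤m x = ≤⁺.trans (proj₂ (v≤F x)) (proj₂ (inner x) (proj₁ (v≤F x)))

  -- The four expressions and their common value.

  module Ratios {a b} (X : FiniteSet a) (Y : FiniteSet b) (x₀ : Element X) (y₀ : Element Y)
                (g : Element X → Element Y → Carrier) (0<g : ∀ x y → 0# < g x y)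
                (h : Element Y → Carrier) (0≤h : ∀ y → 0# ≤ h y) where
    module X = FiniteSet X
    module Y = FiniteSet Y

    meanRatio : Δ Y → Element X → ℝ∞
    meanRatio q x = 𝔼⁺ q (λ y → g x y ÷ h y)

    columnRatio : Δ X → Element Y → ℝ∞
    columnRatio p y = 𝔼 p (λ x → g x y) ÷ h y

    ratio : Δ X → Δ Y → ℝ∞
    ratio p q = 𝔼₂ p q g ÷ 𝔼 q h

    Value : ℝ∞ → Set (a ⊔ b ⊔ c ⊔ ℓ₁ ⊔ ℓ₂)
    Value v = IsMaxMin meanRatio v × IsMinMax columnRatio v ×
              IsMaxMin (λ q p → ratio p q) v × IsMinMax ratio v

    ratio≤ : ∀ p q {v} → (∀ y → columnRatio p y ≤⁺ v) → ratio p q ≤⁺ v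
    ratio≤ p q column≤v = ≤⁺.trans (≤⁺.reflexive (÷-cong (𝔼₂-𝔼ʳ p q g) refl)) (mediant-≤ q 0≤h column≤v)

    ratio-point : ∀ p y → ratio p (point Y y) ≈⁺ columnRatio p y
    ratio-point p y = ÷-cong (trans (𝔼₂-𝔼ʳ p (point Y y) g) (𝔼-point Y y _)) (𝔼-point Y y h)

    -- `p*` caps every column, hence every mixture of columns, at `v`. Two distributions on `Y`
    -- occur because the mean of ratios and the ratio of means weigh columns differently. The cap on
    -- the mean of ratios is the one upper bound not derived here from `p*`, so it enters as
    -- `mean≤v`.
    saddle⇒value : ∀ v (p* : Δ X) (q₁ q₂ : Δ Y) →
                   (∀ y → columnRatio p* y ≤⁺ v) → (∀ x → v ≤⁺ meanRatio q₁ x) → (∀ p → v ≤⁺ ratio p q₂) →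
                   (∀ q → ∃ λ x → meanRatio q x ≤⁺ v) → Value v
    saddle⇒value v p* q₁ q₂ column≤v v≤mean v≤ratio mean≤v =
      isMaxMin (λ q → minimiser X x₀ (meanRatio q)) (q₁ , v≤mean) mean≤v ,
      isMinMax (λ p → maximiser Y y₀ (columnRatio p)) (p* , column≤v)
        -- The best column against `p` dominates `ratio p q₂`, which is at least `v`.
        (λ p → y* p , ≤⁺.trans (v≤ratio p) (ratio≤ p q₂ (column≤ p))) ,
      -- For fixed `q` the denominator is constant and the numerator linear in `p`, so a pure row
      -- attains the inner minimum.
      isMaxMin (λ q → point X (x* q) , λ p → ÷-monoˡ-≤ (𝔼-nonNegative q 0≤h) (least q p))
        (q₂ , v≤ratio) (λ q → p* , ratio≤ p* q column≤v) ,
      -- By the mediant inequality, the point mass on the best column attains the inner maximum.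
      isMinMax (λ p → point Y (y* p) , λ q →
          ≤⁺.trans (ratio≤ p q (column≤ p)) (≤⁺.reflexive (≤⁺.Eq.sym (ratio-point p (y* p)))))
        (p* , λ q → ratio≤ p* q column≤v) (λ p → q₂ , v≤ratio p)
      where
      y* : Δ X → Element Y
      y* p = proj₁ (maximiser Y y₀ (columnRatio p))
      column≤ : ∀ p y → columnRatio p y ≤⁺ columnRatio p (y* p)
      column≤ p = proj₂ (maximiser Y y₀ (columnRatio p))
      x* : Δ Y → Element X
      x* q = proj₁ (minimiser X x₀ λ x → [ 𝔼 q (g x) ])
      least : ∀ q p → 𝔼₂ (point X (x* q)) q g ≤ 𝔼₂ p q g
      least q p = begin
        𝔼₂ (point X (x* q)) q g               ≈⟨ 𝔼₂-𝔼ˡ (point X (x* q)) q g ⟩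
        𝔼 (point X (x* q)) (λ x → 𝔼 q (g x))  ≈⟨ 𝔼-point X (x* q) (λ x → 𝔼 q (g x)) ⟩
        𝔼 q (g (x* q))                        ≤⟨ ≤𝔼 p (λ x → [≤]-injective _≤_ (proj₂ (minimiser X x₀ λ x → [ 𝔼 q (g x) ]) x)) ⟩
        𝔼 p (λ x → 𝔼 q (g x))                 ≈⟨ 𝔼₂-𝔼ˡ p q g ⟨
        𝔼₂ p q g                              ∎

    -- At `⊤⁺` all upper bounds are automatic. The point mass at a zero of `h` puts nonzero weight
    -- on an infinite ratio, and it makes the denominator of `ratio` vanish.
    value-infinite : ∀ i → h (Y.element i) ≈ 0# → Value ⊤⁺
    value-infinite i h≈0 = saddle⇒value ⊤⁺ (point X x₀) (point Y y) (point Y y)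
      (λ _ → _ ≤⊤⁺)
      (λ x → ≤⁺.reflexive (≤⁺.Eq.reflexive (≡.sym (𝔼⁺-⊤⁺ (point Y y) {λ y → g x y ÷ h y} i (mass-point≉0 Y y) (÷-zero (g x y) h≈0)))))
      (λ p → ≤⁺.reflexive (≤⁺.Eq.reflexive (≡.sym (÷-zero (𝔼₂ p (point Y y) g) (trans (𝔼-point Y y h) h≈0)))))
      (λ _ → x₀ , (_ ≤⊤⁺))
      where y = Y.element i

    -- The case of strictly positive `h`.

    module Finite (h≉0 : ∀ y → ¬ (h y ≈ 0#)) where

      h⁻¹ : Element Y → Carrier
      h⁻¹ y = proj₁ (inverse (h y) (h≉0 y))

      h*h⁻¹≈1 : ∀ y → h y * h⁻¹ y ≈ 1#
      h*h⁻¹≈1 y = proj₂ (inverse (h y) (h≉0 y))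

      0≤h⁻¹ : ∀ y → 0# ≤ h⁻¹ y
      0≤h⁻¹ y = inverse-nonNegative (0≤h y) (h*h⁻¹≈1 y)

      meanRatio-[] : ∀ q x → meanRatio q x ≈⁺ [ 𝔼 q (λ y → g x y * h⁻¹ y) ]
      meanRatio-[] q x = 𝔼⁺-[] q λ y → ÷-inverse (g x y) (h*h⁻¹≈1 y)

      G : Fin X.size → Fin Y.size → Carrier
      G i j = g (X.element i) (Y.element j)

      open Duality G (λ i j → 0<⇒≰ (0<g (X.element i) (Y.element j))) (h ∘ Y.element) (0≤h ∘ Y.element) (index Y y₀)
        using (duality)

      value-finite : ∃ Value
      value-finite with duality
      ... | p , q , 0≤p , 0≤q , pG≤h , 1≤Gq , qh≤Σp = [ v ] ,
        saddle⇒value [ v ] p* q₁ q₂ column≤v v≤mean v≤ratio mean≤v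
        where
        -- A row of Gq ≥ 1 forbids `q = 0`. With `h` positive and `q ∙ h ≤ sum p`, this makes
        -- `sum q`, `Q` and `sum p` positive, so all three reciprocals exist.
        q≰0 : ¬ (∀ j → q j ≤ 0#)
        q≰0 q≤0 = 1≰0 (≤-trans (1≤Gq (index X x₀)) (sum-nonPositive λ j →
          ≤-trans (≤-reflexive (*-comm (q j) _)) (*-nonPositive (proj₁ (0<g _ _)) (q≤0 j))))

        Σq≰0 : ¬ (sum q ≤ 0#)
        Σq≰0 Σq≤0 = q≰0 λ j → ≤-trans (term≤sum 0≤q j) Σq≤0

        0≤qh : ∀ j → 0# ≤ q j * h (Y.element j)
        0≤qh j = *-nonNegative (0≤q j) (0≤h (Y.element j))

        Q = q ∙ (h ∘ Y.element)

        Q≰0 : ¬ (Q ≤ 0#)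
        Q≰0 Q≤0 = q≰0 λ j → *-≤0⇒≤0 (λ h≤0 → h≉0 (Y.element j) (≤-antisym h≤0 (0≤h (Y.element j))))
          (≤-trans (≤-reflexive (*-comm _ (q j))) (≤-trans (term≤sum 0≤qh j) Q≤0))

        Σp≰0 : ¬ (sum p ≤ 0#)
        Σp≰0 Σp≤0 = Q≰0 (≤-trans qh≤Σp Σp≤0)

        reciprocal : ∀ {t} → ¬ (t ≤ 0#) → ∃ λ r → 0# ≤ r × t * r ≈ 1#
        reciprocal {t} t≰0 = let r , tr≈1 = inverse t (≰⇒≉ t≰0) in r , inverse-nonNegative (≰⇒≥ t≰0) tr≈1 , tr≈1

        -- The value is the reciprocal of the dual optimum `Q`; `r` and `s` normalise `p` and `q`.
        v = proj₁ (reciprocal Q≰0)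
        0≤v = proj₁ (proj₂ (reciprocal Q≰0))
        Qv≈1 = proj₂ (proj₂ (reciprocal Q≰0))
        r = proj₁ (reciprocal Σp≰0)
        0≤r = proj₁ (proj₂ (reciprocal Σp≰0))
        Σpr≈1 = proj₂ (proj₂ (reciprocal Σp≰0))
        s = proj₁ (reciprocal Σq≰0)
        0≤s = proj₁ (proj₂ (reciprocal Σq≰0))
        Σqs≈1 = proj₂ (proj₂ (reciprocal Σq≰0))

        p* : Δ X
        p* = normalise X p r 0≤p 0≤r Σpr≈1

        q₁ q₂ : Δ Y
        -- The weights `q j * h j` have total `Q`, and their factor `h` cancels the denominators in
        -- the mean of ratios. The ratio of means uses `q` without this reweighting.
        q₁ = normalise Y (λ j → q j * h (Y.element j)) v 0≤qh 0≤v Qv≈1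
        q₂ = normalise Y q s 0≤q 0≤s Σqs≈1

        -- Multiplying `Q ≤ sum p` by `v * r` gives the claim, which weakens the bound `r * h` from
        -- primal feasibility to `v * h`.
        r≤v : r ≤ v
        r≤v = begin
          r                ≈⟨ *-identityʳ r ⟨
          r * 1#           ≈⟨ *-congˡ Qv≈1 ⟨
          r * (Q * v)      ≈⟨ solve 3 (λ r Q v → r :* (Q :* v) := (v :* r) :* Q) refl r Q v ⟩
          (v * r) * Q      ≤⟨ *-monoˡ-≤ (*-nonNegative 0≤v 0≤r) qh≤Σp ⟩
          (v * r) * sum p  ≈⟨ solve 3 (λ v r P → (v :* r) :* P := v :* (P :* r)) refl v r (sum p) ⟩
          v * (sum p * r)  ≈⟨ *-congˡ Σpr≈1 ⟩
          v * 1#           ≈⟨ *-identityʳ v ⟩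
          v                ∎

        𝔼p*≤vh : ∀ y → 𝔼 p* (λ x → g x y) ≤ v * h y
        𝔼p*≤vh = ∀-element Y _ λ j → begin
          𝔼 p* (λ x → g x (Y.element j))  ≈⟨ 𝔼-normalise X p r 0≤p 0≤r Σpr≈1 (λ x → g x (Y.element j)) ⟩
          r * (p ∙ (λ i → G i j))         ≤⟨ *-monoˡ-≤ 0≤r (pG≤h j) ⟩
          r * h (Y.element j)             ≈⟨ *-comm r _ ⟩
          h (Y.element j) * r             ≤⟨ *-monoˡ-≤ (0≤h (Y.element j)) r≤v ⟩
          h (Y.element j) * v             ≈⟨ *-comm _ v ⟩
          v * h (Y.element j)             ∎

        column≤v : ∀ y → columnRatio p* y ≤⁺ [ v ]
        column≤v y = ≤⇒÷≤ (0≤h y) (h≉0 y) (𝔼p*≤vh y)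

        v≤mean : ∀ x → [ v ] ≤⁺ meanRatio q₁ x
        v≤mean = ∀-element X _ λ i → ≤⁺.trans [ begin
          v                  ≈⟨ *-identityʳ v ⟨
          v * 1#             ≤⟨ *-monoˡ-≤ 0≤v (1≤Gq i) ⟩
          v * (q ∙ G i)      ≈⟨ *-congˡ (sum-cong-≋ λ j → cancel (q j) (G i j) (Y.element j)) ⟨
          v * ((λ j → q j * h (Y.element j)) ∙ (λ j → G i j * h⁻¹ (Y.element j)))
                             ≈⟨ 𝔼-normalise Y _ v 0≤qh 0≤v Qv≈1 (λ y → g (X.element i) y * h⁻¹ y) ⟨
          𝔼 q₁ (λ y → g (X.element i) y * h⁻¹ y) ∎ ]
          (≤⁺.reflexive (≤⁺.Eq.sym (meanRatio-[] q₁ (X.element i))))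
          where
          cancel : ∀ a b y → (a * h y) * (b * h⁻¹ y) ≈ a * b
          cancel a b y = trans
            (solve 4 (λ a h b k → (a :* h) :* (b :* k) := (a :* b) :* (h :* k)) refl a (h y) b (h⁻¹ y))
            (trans (*-congˡ (h*h⁻¹≈1 y)) (*-identityʳ (a * b)))

        s≤𝔼q₂g : ∀ x → s ≤ 𝔼 q₂ (g x)
        s≤𝔼q₂g = ∀-element X _ λ i → begin
          s                     ≈⟨ *-identityʳ s ⟨
          s * 1#                ≤⟨ *-monoˡ-≤ 0≤s (1≤Gq i) ⟩
          s * (q ∙ G i)         ≈⟨ 𝔼-normalise Y q s 0≤q 0≤s Σqs≈1 (g (X.element i)) ⟨
          𝔼 q₂ (g (X.element i)) ∎

        -- The mean of `h` under `q₂` is `s * Q`, so the threshold `v * 𝔼 q₂ h` collapses to `s`,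
        -- which every row reaches.
        v≤ratio : ∀ p → [ v ] ≤⁺ ratio p q₂
        v≤ratio p = ≤⇒≤÷ (𝔼-nonNegative q₂ 0≤h) (begin
          v * 𝔼 q₂ h              ≈⟨ *-congˡ (𝔼-normalise Y q s 0≤q 0≤s Σqs≈1 h) ⟩
          v * (s * Q)             ≈⟨ solve 3 (λ v s Q → v :* (s :* Q) := s :* (Q :* v)) refl v s Q ⟩
          s * (Q * v)             ≈⟨ *-congˡ Qv≈1 ⟩
          s * 1#                  ≈⟨ *-identityʳ s ⟩
          s                       ≤⟨ ≤𝔼 p s≤𝔼q₂g ⟩
          𝔼 p (λ x → 𝔼 q₂ (g x))  ≈⟨ 𝔼₂-𝔼ˡ p q₂ g ⟨
          𝔼₂ p q₂ g               ∎)

        -- The least row mean is at most the `p*`-average of the row means; after exchanging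
        -- expectations, each column contributes at most `v`.
        mean≤v : ∀ q → ∃ λ x → meanRatio q x ≤⁺ [ v ]
        mean≤v q = x , ≤⁺.trans (≤⁺.reflexive (meanRatio-[] q x)) [ begin
          mean x                                            ≤⟨ ≤𝔼 p* (λ x′ → [≤]-injective _≤_ (x-least x′)) ⟩
          𝔼 p* mean                                         ≈⟨ 𝔼-swap p* q (λ x y → g x y * h⁻¹ y) ⟩
          𝔼 q (λ y → 𝔼 p* (λ x → g x y * h⁻¹ y))            ≤⟨ 𝔼≤ q column ⟩
          v                                                 ∎ ]
          where
          mean : Element X → Carrier
          mean x = 𝔼 q (λ y → g x y * h⁻¹ y)
          x = proj₁ (minimiser X x₀ ([_] ∘ mean))
          x-least = proj₂ (minimiser X x₀ ([_] ∘ mean))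
          column : ∀ y → 𝔼 p* (λ x → g x y * h⁻¹ y) ≤ v
          column y = begin
            𝔼 p* (λ x → g x y * h⁻¹ y)  ≈⟨ 𝔼-cong p* (λ x → *-comm (g x y) (h⁻¹ y)) ⟩
            𝔼 p* (λ x → h⁻¹ y * g x y)  ≈⟨ 𝔼-scale p* (h⁻¹ y) (λ x → g x y) ⟩
            h⁻¹ y * 𝔼 p* (λ x → g x y)  ≤⟨ *-monoˡ-≤ (0≤h⁻¹ y) (𝔼p*≤vh y) ⟩
            h⁻¹ y * (v * h y)           ≈⟨ solve 3 (λ k v h → k :* (v :* h) := v :* (h :* k)) refl (h⁻¹ y) v (h y) ⟩
            v * (h y * h⁻¹ y)           ≈⟨ *-congˡ (h*h⁻¹≈1 y) ⟩
            v * 1#                      ≈⟨ *-identityʳ v ⟩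
            v                           ∎

    value-exists : ∃ Value
    value-exists with any? (λ i → h (Y.element i) ≟ 0#)
    ... | yes (i , h≈0) = ⊤⁺ , value-infinite i h≈0
    ... | no  h≉0       = Finite.value-finite (∀-element Y _ λ i h≈0 → h≉0 (i , h≈0))

-- Equality of the four expressions is rendered as one `v` that is the value of each; the given
-- elements make both sets nonempty, so that the extrema range over something.
theorem9 : ∀ {c ℓ₁ ℓ₂ a b} (ℝ : Reals c ℓ₁ ℓ₂) →
  let open Reals ℝ
      open Extended ℝ
  in
  (X : FiniteSet a) (Y : FiniteSet b) → Element X → Element Y →
  (g : Element X → Element Y → Carrier) → (∀ x y → 0# < g x y) →
  (h : Element Y → Carrier) → (∀ y → 0# ≤ h y) →
  ∃ λ (v : ℝ∞) →
    IsMaxMin (λ (q : Δ Y) (x : Element X) → 𝔼⁺ q (λ y → g x y ÷ h y)) v ×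
    IsMinMax (λ (p : Δ X) (y : Element Y) → 𝔼 p (λ x → g x y) ÷ h y) v ×
    IsMaxMin (λ (q : Δ Y) (p : Δ X) → 𝔼₂ p q g ÷ 𝔼 q h) v ×
    IsMinMax (λ (p : Δ X) (q : Δ Y) → 𝔼₂ p q g ÷ 𝔼 q h) v
theorem9 ℝ X Y x₀ y₀ g 0<g h 0≤h = Expectations.Ratios.value-exists ℝ X Y x₀ y₀ g 0<g h 0≤h
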